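{- Let $k,d$ be positive integers and let $\Gamma$ be a finite, simple, strongly connected digraph with $\dim(\Gamma)=k$ and diameter $d$. Then $$k+d\leq |A(\Gamma)|\leq \Big(\frac{d^2+3d-2}{2}\Big)^{2k}+(2k-d)d^{2k-1}+k^2-k.$$ Moreover: (i) the lower bound is attained if and only if $k=1$ and $\Gamma$ is isomorphic to a directed cycle of length $d+1$; (ii) the upper bound is attained if and only if one of the following holds: (a) $k=1$ and $\Gamma$ is isomorphic to $\Gamma(d^2+1,d)$; (b) $d=1$ and $\Gamma$ is isomorphic to the complete digraph of order $k+1$; (c) $d=2$ and $\Gamma$ is isomorphic to $\overline{\Gamma}(4^k+k,2)$.
   Context: All digraphs are finite, simple (no loops, at most one arc per ordered pair) and strongly connected; $A(\Gamma)$ is the arc set. $\partial(x,y)$ is the length of a shortest directed path from $x$ to $y$, $\tilde\partial(x,y)=(\partial(x,y),\partial(y,x))$, and the diameter is $\max_{x,y}\partial(x,y)$. A set $\{w_1,\dots,w_m\}\subseteq V(\Gamma)$ is weakly resolving if $(\tilde\partial(w_1,u),\dots,\tilde\partial(w_m,u))\neq(\tilde\partial(w_1,v),\dots,\tilde\partial(w_m,v))$ for all distinct $u,v$; $\dim(\Gamma)$ is the minimum size of a weakly resolving set. The complete digraph has every ordered pair of distinct vertices as an arc. For positive integers $k,d$, the digraph $\Gamma(d^{2k}+k,d)$ has vertex set $\{u_1,\dots,u_k\}\cup\{1,\dots,d\}^{2k}$ (the $u_i$ are $k$ extra vertices, the others are $2k$-tuples), and its arcs are exactly: (F1) $(u_i,(a_1,\dots,a_{2k}))$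 whenever $a_{2i-1}=1$; (F2) $((a_1,\dots,a_{2k}),u_i)$ whenever $a_{2i}=1$; (F3) $((a_1,\dots,a_{2k}),(b_1,\dots,b_{2k}))$ whenever the tuples are distinct and $a_{2r-1}-b_{2r-1}\geq -1$ and $a_{2r}-b_{2r}\leq 1$ for every $r=1,\dots,k$. (There are no arcs between distinct $u_i,u_j$.) The digraph $\overline{\Gamma}(d^{2k}+k,d)$ is obtained from $\Gamma(d^{2k}+k,d)$ by adding both arcs $(u_i,u_j)$ and $(u_j,u_i)$ for all $1\leq i<j\leq k$. -}

module Defs where

open import Data.Nat using (ℕ; zero; suc; _+_; _*_; _∸_; _^_; _≤_)
open import Data.Nat.DivMod using (_/_)
open import Data.Integer as ℤ using (ℤ; +_)
open import Data.Fin using (Fin; toℕ)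
open import Data.Fin.Subset using (Subset; _∈_; ∣_∣)
open import Data.Bool using (Bool; true; false; if_then_else_)
open import Data.Vec using (Vec; lookup; tabulate)
open import Data.Vec using () renaming (sum to vsum)
open import Data.Product using (Σ; ∃; ∃-syntax; _×_; proj₁; proj₂)
open import Data.Sum using (_⊎_)
open import Relation.Nullary using (¬_)
open import Relation.Binary.PropositionalEquality using (_≡_; _≢_)
open import Function.Bundles using (_↔_; _⇔_; Inverse)

record Digraph : Set where
  field
    n       : ℕ
    arc     : Fin n → Fin n → Bool
    noLoops : ∀ i → arc i i ≡ false
open Digraph public

arcCount : Digraph → ℕ
arcCount G = vsum (tabulate λ i → vsum (tabulate λ j → if arc G i j then 1 else 0))

data Walk (G : Digraph) : Fin (n G) → Fin (n G) → ℕ → Set where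
  nil  : ∀ {x} → Walk G x x 0
  cons : ∀ {x y z m} → arc G x y ≡ true → Walk G y z m → Walk G x z (suc m)

StronglyConnected : Digraph → Set
StronglyConnected G = ∀ x y → ∃[ m ] Walk G x y m

Dist : (G : Digraph) → Fin (n G) → Fin (n G) → ℕ → Set
Dist G x y m = Walk G x y m × (∀ m′ → Walk G x y m′ → m ≤ m′)

IsDiameter : Digraph → ℕ → Set
IsDiameter G d = (∀ x y m → Dist G x y m → m ≤ d) × (∃[ x ] ∃[ y ] Dist G x y d)

WeaklyResolving : (G : Digraph) → Subset (n G) → Set
WeaklyResolving G W = ∀ u v →
  (∀ w → w ∈ W → ∀ m → (Dist G w u m ⇔ Dist G w v m) × (Dist G u w m ⇔ Dist G v w m)) →
  u ≡ v

IsDim : Digraph → ℕ → Set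
IsDim G k = (∃[ W ] (WeaklyResolving G W × ∣ W ∣ ≡ k))
          × (∀ W → WeaklyResolving G W → k ≤ ∣ W ∣)

Iso : (G : Digraph) → (V : Set) → (V → V → Set) → Set
Iso G V R = Σ (Fin (n G) ↔ V) λ f →
  ∀ x y → (arc G x y ≡ true ⇔ R (Inverse.to f x) (Inverse.to f y))

CycleArc : (d : ℕ) → Fin (suc d) → Fin (suc d) → Set
CycleArc d i j = (toℕ j ≡ suc (toℕ i)) ⊎ (toℕ i ≡ d × toℕ j ≡ 0)

CompleteArc : (m : ℕ) → Fin m → Fin m → Set
CompleteArc m i j = i ≢ j

-- Vertex set of Γ(d^{2k}+k,d): the u_i (i ∈ Fin k) and tuples in {1..d}^{2k}.
-- A tuple (a_1,…,a_{2k}) is stored as the vector of k pairs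
-- ((a_1,a_2),…,(a_{2k-1},a_{2k})); the entry value t ∈ {1..d} is stored as
-- the element t-1 of Fin d.
GVert : ℕ → ℕ → Set
GVert k d = Fin k ⊎ Vec (Fin d × Fin d) k

data GammaArc (k d : ℕ) : GVert k d → GVert k d → Set where
  F1 : ∀ i a → toℕ (proj₁ (lookup a i)) ≡ 0 → GammaArc k d (Data.Sum.inj₁ i) (Data.Sum.inj₂ a)
  F2 : ∀ i a → toℕ (proj₂ (lookup a i)) ≡ 0 → GammaArc k d (Data.Sum.inj₂ a) (Data.Sum.inj₁ i)
  F3 : ∀ a b → a ≢ b →
       (∀ r → toℕ (proj₁ (lookup b r)) ≤ suc (toℕ (proj₁ (lookup a r)))) →
       (∀ r → toℕ (proj₂ (lookup a r)) ≤ suc (toℕ (proj₂ (lookup b r)))) →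
       GammaArc k d (Data.Sum.inj₂ a) (Data.Sum.inj₂ b)

data GammaBarArc (k d : ℕ) : GVert k d → GVert k d → Set where
  old : ∀ {x y} → GammaArc k d x y → GammaBarArc k d x y
  uu  : ∀ i j → i ≢ j → GammaBarArc k d (Data.Sum.inj₁ i) (Data.Sum.inj₁ j)

-- ((d²+3d-2)/2)^{2k} + (2k-d) d^{2k-1} + k² - k  (as an integer; d²+3d-2 is even)
upperBound : ℕ → ℕ → ℤ
upperBound k d =
  (+ (((d * d + 3 * d ∸ 2) / 2) ^ (2 * k)))
  ℤ.+ ((+ (2 * k) ℤ.- + d) ℤ.* + (d ^ (2 * k ∸ 1)))
  ℤ.+ (+ (k * k) ℤ.- + k)

{-# OPTIONS --safe #-}
module Submission where

-- Upper bound.  Send a vertex outside a minimum resolving set {w_1,…,w_k} to the 2k-tuple of its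
-- distances from and to the w_i, and w_i to u_i.  Resolving means that this map into Γ̄(d^{2k}+k,d)
-- is injective, and by the triangle inequality it preserves arcs, so |A(Γ)| is at most the number
-- of arcs of Γ̄, with equality only if the map is an isomorphism.  If k ≥ 2 and d ≥ 3 the arcs
-- between the u_i shorten distances, so equality is then impossible; for k = 1 and for d = 1 the
-- digraph Γ̄ is Γ(d²+1,d) and the complete digraph.
--
-- Lower bound.  If x_0,…,x_d is a geodesic, the vertices other than x_1,…,x_d resolve Γ, so
-- k + d ≤ |V(Γ)|; and |V(Γ)| ≤ |A(Γ)| because every vertex has an out-arc.  In the case of equality
-- out-arcs are unique, and a strongly connected functional digraph is a directed cycle.

open import Defs
open import Data.Nat using (ℕ; zero; suc; pred; _+_; _*_; _∸_; _^_; _≤_; z≤n; s≤s)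
open import Data.Nat.Properties
open import Data.Nat.DivMod using (_/_; m*n/n≡m)
open import Data.Nat.Solver using (module +-*-Solver)
open import Data.Integer as ℤ using (+_) renaming (_≤_ to _≤ℤ_)
import Data.Integer.Properties as ℤ
import Data.Integer.Solver as ℤ-Solver
open import Data.Bool using (Bool; true; false; if_then_else_)
import Data.Bool.Properties as Bool
open import Data.Product using (Σ; ∃; ∃₂; ∃-syntax; _×_; _,_; proj₁; proj₂; uncurry)
open import Data.Product.Properties using (,-injective)
import Data.Product.Properties as Product
import Data.Sum.Properties as Sum
open import Data.Sum.Function.Propositional using (_⊎-↔_)
open import Function.Properties.Inverse using (↔-refl; ↔-sym; ↔-trans)
open import Function.Properties.Equivalence using () renaming (trans to ⇔-trans; sym to ⇔-sym)
open import Data.Sum using (_⊎_; inj₁; inj₂; [_,_]′)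
open import Data.Empty using (⊥; ⊥-elim)
open import Data.Unit using (⊤; tt)
open import Data.Fin using (Fin; zero; suc; toℕ; fromℕ<)
open import Data.Fin.Properties as Fin using (toℕ-injective; toℕ<n; toℕ-fromℕ<; any?)
open import Data.Fin.Subset using (Subset; inside; outside; ∣_∣) renaming (_∈_ to _∈ₛ_)
open import Data.Vec as Vec using (Vec; []; _∷_; lookup; here; there)
open import Data.Vec using () renaming (sum to vsum)
open import Data.Vec.Properties using (lookup∘tabulate; lookup⇒[]=; []=⇒lookup; ∷-injective; ≡-dec; lookup-replicate)
open import Data.List as List using (List; []; _∷_; _++_; length; map; filter; allFin; cartesianProductWith; removeAt)
open import Data.List.Properties using (length-map; length-++; length-removeAt′; length-tabulate)
open import Data.List.Membership.Propositional using (_∈_)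
open import Data.List.Membership.Propositional.Properties
open import Data.List.Relation.Unary.Any as Any using (here; there; index)
open import Data.List.Relation.Unary.Any.Properties using (lookup-index)
open import Data.List.Relation.Unary.All as All using (All; []; _∷_)
open import Data.List.Relation.Unary.AllPairs using ([]; _∷_)
open import Data.List.Relation.Unary.Unique.Propositional using (Unique)
import Data.List.Relation.Unary.Unique.Propositional.Properties as Unique
open import Function using (_∘_; id)
open import Function.Bundles using (_⇔_; _↔_; mk⇔; mk↔ₛ′; Inverse; Equivalence)
open import Relation.Nullary using (¬_; Dec; yes; no; does; contradiction)
open import Relation.Nullary.Decidable using (_×-dec_; ¬?; map′; dec-true; dec-false)
open import Relation.Unary using (Decidable)
open import Relation.Binary using (DecidableEquality)
open import Relation.Binary.PropositionalEquality using (_≡_; _≢_; refl; sym; trans; cong; cong₂; subst; subst₂; module ≡-Reasoning)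

-- Counting

∈-removeAt : {A : Set} {x y : A} {ys : List A} (x∈ys : x ∈ ys) → y ∈ ys → y ≢ x →
             y ∈ removeAt ys (index x∈ys)
∈-removeAt (here refl) (here refl)  y≢x = contradiction refl y≢x
∈-removeAt (here _)    (there y∈ys) y≢x = y∈ys
∈-removeAt (there _)   (here y≡)    y≢x = here y≡
∈-removeAt (there p)   (there y∈ys) y≢x = there (∈-removeAt p y∈ys y≢x)

-- Induction on `xs`: delete from `ys` one occurrence of the head. The remaining members of `xs`
-- differ from the head, so they survive the deletion.
unique-⊆⇒length≤ : {A : Set} {xs ys : List A} → Unique xs →
                   (∀ {x} → x ∈ xs → x ∈ ys) → length xs ≤ length ys
unique-⊆⇒length≤ [] _ = z≤n
unique-⊆⇒length≤ {xs = x ∷ xs} {ys} (x∉xs ∷ u) sub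
  rewrite length-removeAt′ ys (index (sub (here refl)))
  = s≤s (unique-⊆⇒length≤ u λ y∈xs →
      ∈-removeAt (sub (here refl)) (sub (there y∈xs)) (λ { refl → All.lookup x∉xs y∈xs refl }))

-- Only elements are listed, never proofs, so `P x` may have several proofs without affecting the
-- count. A predicate is counted instead of a type so that arcs can be counted among all pairs of
-- vertices.
record Count {A : Set} (P : A → Set) (m : ℕ) : Set where
  field
    list     : List A
    unique   : Unique list
    sound    : ∀ {x} → x ∈ list → P x
    complete : ∀ {x} → P x → x ∈ list
    size     : length list ≡ m
open Count

module _ {A : Set} where

  count-resp : {P Q : A → Set} {m : ℕ} → (∀ {x} → P x → Q x) → (∀ {x} → Q x → P x) →
               Count P m → Count Q m
  count-resp f g c = record
    { list = list c ; unique = unique c ; sound = f ∘ sound c ; complete = complete c ∘ g ; size = size c }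

  count-⊎ : {P Q : A → Set} {m n : ℕ} → (∀ {x} → P x → Q x → ⊥) →
            Count P m → Count Q n → Count (λ x → P x ⊎ Q x) (m + n)
  count-⊎ disj c c′ = record
    { list = list c ++ list c′
    ; unique = Unique.++⁺ (unique c) (unique c′) (λ (p , q) → disj (sound c p) (sound c′ q))
    ; sound = λ p → [ inj₁ ∘ sound c , inj₂ ∘ sound c′ ]′ (∈-++⁻ (list c) p)
    ; complete = [ ∈-++⁺ˡ ∘ complete c , ∈-++⁺ʳ (list c) ∘ complete c′ ]′
    ; size = trans (length-++ (list c)) (cong₂ _+_ (size c) (size c′)) }

  count-∅ : {P : A → Set} → (∀ {x} → ¬ P x) → Count P 0
  count-∅ ¬p = record
    { list = [] ; unique = [] ; sound = λ () ; complete = λ p → ⊥-elim (¬p p) ; size = refl }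

  count-filter : {P Q : A → Set} {m : ℕ} → Decidable Q → Count P m →
                 ∃[ l ] Count (λ x → P x × Q x) l
  count-filter Q? c = _ , record
    { list = filter Q? (list c)
    ; unique = Unique.filter⁺ Q? (unique c)
    ; sound = λ p → let q , r = ∈-filter⁻ Q? p in sound c q , r
    ; complete = λ (p , q) → ∈-filter⁺ Q? (complete c p) q
    ; size = refl }

count-singleton : {A : Set} (a : A) → Count (_≡ a) 1
count-singleton a = record
  { list = a ∷ [] ; unique = [] ∷ [] ; sound = λ { (here p) → p } ; complete = here ; size = refl }

count-Fin : (n : ℕ) → Count {Fin n} (λ _ → ⊤) n
count-Fin n = record
  { list = allFin n ; unique = Unique.allFin⁺ n ; sound = _ ; complete = λ _ → ∈-allFin _
  ; size = length-tabulate id }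

module _ {A B : Set} {P : A → Set} {m : ℕ} (f : A → B) where

  count-image : (∀ {x y} → f x ≡ f y → x ≡ y) → Count P m →
                Count (λ y → ∃[ x ] P x × y ≡ f x) m
  count-image inj c = record
    { list = map f (list c)
    ; unique = Unique.map⁺ inj (unique c)
    ; sound = λ p → let x , x∈ , e = ∈-map⁻ f p in x , sound c x∈ , e
    ; complete = λ { (x , p , refl) → ∈-map⁺ f (complete c p) }
    ; size = trans (length-map f (list c)) (size c) }

length-cartesianProductWith : {A B C : Set} (f : A → B → C) (xs : List A) (ys : List B) →
                              length (cartesianProductWith f xs ys) ≡ length xs * length ys
length-cartesianProductWith f [] ys = refl
length-cartesianProductWith f (x ∷ xs) ys = trans (length-++ (map (f x) ys))
  (cong₂ _+_ (length-map (f x) ys) (length-cartesianProductWith f xs ys))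

count-image₂ : {A B C : Set} {P : A → Set} {Q : B → Set} {m n : ℕ} (f : A → B → C) →
               (∀ {w x y z} → f w y ≡ f x z → w ≡ x × y ≡ z) → Count P m → Count Q n →
               Count (λ z → ∃₂ λ x y → P x × Q y × z ≡ f x y) (m * n)
count-image₂ f inj c c′ = record
  { list = cartesianProductWith f (list c) (list c′)
  ; unique = Unique.cartesianProductWith⁺ f inj (unique c) (unique c′)
  ; sound = λ p → let x , y , x∈ , y∈ , e = ∈-cartesianProductWith⁻ f (list c) (list c′) p
                  in x , y , sound c x∈ , sound c′ y∈ , e
  ; complete = λ { (x , y , p , q , refl) → ∈-cartesianProductWith⁺ f (complete c p) (complete c′ q) }
  ; size = trans (length-cartesianProductWith f (list c) (list c′)) (cong₂ _*_ (size c) (size c′)) }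

count-all₂ : {A B C : Set} {m n : ℕ} (f : A → B → C) →
             (∀ {w x y z} → f w y ≡ f x z → w ≡ x × y ≡ z) → (∀ z → ∃₂ λ x y → z ≡ f x y) →
             Count {A} (λ _ → ⊤) m → Count {B} (λ _ → ⊤) n → Count {C} (λ _ → ⊤) (m * n)
count-all₂ f inj surj c c′ = count-resp _
  (λ {z} _ → let x , y , e = surj z in x , y , tt , tt , e) (count-image₂ f inj c c′)

-- Asking for injectivity on `P` alone lets `cycle-arcCount` map an arc to its tail, which is
-- injective on arcs but not on pairs.
unique-map : {A B : Set} {P : A → Set} (f : A → B) → (∀ {x y} → P x → P y → f x ≡ f y → x ≡ y) →
             {xs : List A} → (∀ {x} → x ∈ xs → P x) → Unique xs → Unique (map f xs)
unique-map f inj all [] = []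
unique-map f inj {x ∷ xs} all (x∉xs ∷ u) =
  All.tabulate (λ y∈ fx≡y → let z , z∈ , y≡fz = ∈-map⁻ f y∈ in
    All.lookup x∉xs z∈ (inj (all (here refl)) (all (there z∈)) (trans fx≡y y≡fz)))
  ∷ unique-map f inj (all ∘ there) u

module _ {A B : Set} {P : A → Set} {Q : B → Set} {m n : ℕ}
         (f : A → B) (pres : ∀ {x} → P x → Q (f x))
         (inj : ∀ {x y} → P x → P y → f x ≡ f y → x ≡ y)
         (c : Count P m) (c′ : Count Q n) where

  private
    fs : List B
    fs = map f (list c)

    fs-unique : Unique fs
    fs-unique = unique-map f inj (sound c) (unique c)

    fs⊆ : ∀ {y} → y ∈ fs → y ∈ list c′
    fs⊆ y∈ = let x , x∈ , e = ∈-map⁻ f y∈ in complete c′ (subst Q (sym e) (pres (sound c x∈)))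

    fs-size : length fs ≡ m
    fs-size = trans (length-map f (list c)) (size c)

  count-≤ : m ≤ n
  count-≤ = subst₂ _≤_ fs-size (size c′) (unique-⊆⇒length≤ fs-unique fs⊆)

  -- An element missed by f could be added to the image, which would then be too long.
  count-onto : DecidableEquality B → m ≡ n → ∀ {y} → Q y → ∃[ x ] P x × y ≡ f x
  count-onto _≟_ m≡n {y} q with Any.any? (y ≟_) fs
  ... | yes y∈ = let x , x∈ , e = ∈-map⁻ f y∈ in x , sound c x∈ , e
  ... | no y∉ = contradiction
    (subst₂ _≤_ (cong suc fs-size) (trans (size c′) (sym m≡n))
      (unique-⊆⇒length≤ {xs = y ∷ fs}
        (All.tabulate (λ z∈ y≡z → y∉ (subst (_∈ fs) (sym y≡z) z∈)) ∷ fs-unique)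
        λ { (here refl) → complete c′ q ; (there z∈) → fs⊆ z∈ }))
    1+n≰n

count-functional : {A : Set} {P : A → Set} {m n : ℕ} → Count P m → Count P n → m ≡ n
count-functional c c′ = ≤-antisym (count-≤ id id (λ _ _ e → e) c c′) (count-≤ id id (λ _ _ e → e) c′ c)

-- By `rfl` the diagonal lies in `R`, and it is a copy of `A`; adding it back gives all of `R`. The
-- equation with `+` avoids truncated subtraction.
count-off-diagonal : {A : Set} {R : A → A → Set} {m n : ℕ} → DecidableEquality A →
  (∀ {x} → R x x) → Count {A} (λ _ → ⊤) n → Count (uncurry R) m →
  ∃[ l ] Count {A × A} (λ (x , y) → R x y × x ≢ y) l × l + n ≡ m
count-off-diagonal {A} {R} _≟_ rfl cA cR with count-filter (λ (x , y) → ¬? (x ≟ y)) cR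
... | l , c = l , c , count-functional
  (count-resp (λ { (inj₁ (r , _)) → r ; (inj₂ (x , _ , refl)) → rfl }) split
    (count-⊎ (λ { (_ , ne) (x , _ , refl) → ne refl }) c diagonal)) cR
  where
  diagonal = count-image {B = A × A} (λ x → x , x) (cong proj₁) cA
  split : ∀ {p : A × A} → uncurry R p → (uncurry R p × proj₁ p ≢ proj₂ p) ⊎ (∃[ x ] ⊤ × p ≡ (x , x))
  split {x , y} r with x ≟ y
  ... | yes refl = inj₂ (x , tt , refl)
  ... | no ne = inj₁ (r , ne)

-- `arcCount` is a double `vsum`; this evaluates both the outer sum over tails and the inner sum
-- over heads.
count-Σ : {A : Set} (n : ℕ) (f : Fin n → ℕ) {P : Fin n → A → Set} → (∀ i → Count (P i) (f i)) →
          Count (uncurry P) (vsum (Vec.tabulate f))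
count-Σ zero f c = count-∅ λ { {() , _} }
count-Σ (suc n) f {P} c = count-resp
  (λ { (inj₁ (_ , p , refl)) → p ; (inj₂ (_ , p , refl)) → p })
  (λ { {zero , x} p → inj₁ (x , p , refl) ; {suc i , x} p → inj₂ ((i , x) , p , refl) })
  (count-⊎ (λ { (_ , _ , refl) (_ , _ , ()) })
    (count-image (zero ,_) (cong proj₂) (c zero))
    (count-image (λ (i , x) → suc i , x) (λ { refl → refl }) (count-Σ n (f ∘ suc) (c ∘ suc))))

count-arcs : (G : Digraph) → Count (λ (x , y) → arc G x y ≡ true) (arcCount G)
count-arcs G = count-Σ (n G) _ λ i → count-resp
  (λ { ((j , _) , p , refl) → p }) (λ {j} p → (j , tt) , p , refl)
  (count-image proj₁ (λ { refl → refl })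
    (count-Σ (n G) _ λ j → cell (arc G i j)))
  where
  -- A matrix entry becomes a count of the one-point type, of size 1 or 0 as in `arcCount`.
  cell : (b : Bool) → Count {⊤} (λ _ → b ≡ true) (if b then 1 else 0)
  cell true = count-resp (λ _ → refl) (λ _ → refl) (count-singleton tt)
  cell false = count-∅ λ ()

count-subset : {n : ℕ} (W : Subset n) → Count (_∈ₛ W) ∣ W ∣
count-subset [] = count-∅ λ { {()} }
count-subset (b ∷ W) with b | count-image suc Fin.suc-injective (count-subset W)
... | inside | c = count-resp
  (λ { (inj₁ refl) → here ; (inj₂ (_ , p , refl)) → there p })
  (λ { here → inj₁ refl ; (there p) → inj₂ (_ , p , refl) })
  (count-⊎ (λ { refl (_ , _ , ()) }) (count-singleton zero) c)
... | outside | c = count-resp (λ { (_ , p , refl) → there p }) (λ { (there p) → _ , p , refl }) c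

-- The arcs of Γ̄(d^{2k}+k,d)

module _ {A : Set} {m : ℕ} (all : Count {A} (λ _ → ⊤) m) where

  count-Vec : (k : ℕ) → Count {Vec A k} (λ _ → ⊤) (m ^ k)
  count-Vec zero = count-resp _ (λ { {[]} _ → refl }) (count-singleton [])
  count-Vec (suc k) = count-all₂ _∷_ ∷-injective (λ { (x ∷ xs) → x , xs , refl }) all (count-Vec k)

  -- Choose the position, an entry of `Z` for it, and the other `pred k` entries freely. At `k = 0`
  -- the truncated `pred` does no harm, since the product then has the factor 0.
  count-lookup : {Z : A → Set} {z : ℕ} → Count Z z → (k : ℕ) →
                 Count {Fin k × Vec A k} (λ (i , a) → Z (lookup a i)) (k * (z * m ^ pred k))
  count-lookup {Z} {z} cZ k = subst (Count _) (size-formula k) (go k)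
    where
    sizes : ℕ → ℕ
    sizes zero = 0
    sizes (suc k) = z * m ^ k + m * sizes k

    size-formula : ∀ k → sizes k ≡ k * (z * m ^ pred k)
    size-formula zero = refl
    -- The exponent `pred k` in the induction hypothesis is a true predecessor only for `k`
    -- positive, so length 1 is treated apart.
    size-formula (suc zero) = cong (λ t → z * 1 + t) (*-zeroʳ m)
    size-formula (suc (suc k)) rewrite size-formula (suc k) =
      solve 4 (λ m z p l → z :* (m :* p) :+ m :* (z :* p :+ l :* (z :* p)) :=
                           z :* (m :* p) :+ (z :* (m :* p) :+ l :* (z :* (m :* p))))
        refl m z (m ^ k) k
      where open +-*-Solver

    go : ∀ k → Count {Fin k × Vec A k} (λ (i , a) → Z (lookup a i)) (sizes k)
    go zero = count-∅ λ { {() , _} }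
    go (suc k) = count-resp
      (λ { (inj₁ (_ , _ , p , _ , refl)) → p ; (inj₂ (_ , _ , _ , p , refl)) → p })
      (λ { {zero , x ∷ a} p → inj₁ (x , a , p , tt , refl)
         ; {suc i , x ∷ a} p → inj₂ (x , (i , a) , tt , p , refl) })
      (count-⊎ (λ { (_ , _ , _ , _ , refl) (_ , _ , _ , _ , ()) })
        (count-image₂ (λ x a → zero , x ∷ a) (λ { refl → refl , refl }) cZ (count-Vec k))
        (count-image₂ (λ x (i , a) → suc i , x ∷ a) (λ { refl → refl , refl }) all (go k)))

count-pointwise : {A : Set} {S : A → A → Set} {s : ℕ} → Count (uncurry S) s → (k : ℕ) →
  Count {Vec A k × Vec A k} (λ (a , b) → ∀ r → S (lookup a r) (lookup b r)) (s ^ k)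
count-pointwise c zero = count-resp (λ _ ()) (λ { {[] , []} _ → refl }) (count-singleton ([] , []))
count-pointwise c (suc k) = count-resp
  (λ { (_ , _ , s , ss , refl) → λ { zero → s ; (suc r) → ss r } })
  (λ { {x ∷ a , y ∷ b} ss → (x , y) , (a , b) , ss zero , ss ∘ suc , refl })
  (count-image₂ (λ (x , y) (a , b) → x ∷ a , y ∷ b) (λ { refl → refl , refl }) c (count-pointwise c k))

-- With d = `suc e` this is (d²+3d-2)/2, the number of pairs x, y below d with y ≤ x + 1. In the
-- recursion, x = 0 allows two values of y, y = 0 allows `suc e` positive values of x, and the pairs
-- with both positive are a shifted copy of the smaller case.
nearlyBelow : ℕ → ℕ
nearlyBelow zero = 1
nearlyBelow (suc e) = 2 + suc e + nearlyBelow e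

count-nearlyBelow : (e : ℕ) →
  Count {Fin (suc e) × Fin (suc e)} (λ (x , y) → toℕ y ≤ suc (toℕ x)) (nearlyBelow e)
count-nearlyBelow zero = count-resp (λ { refl → z≤n }) (λ { {zero , zero} _ → refl })
  (count-singleton (zero , zero))
count-nearlyBelow (suc e) = count-resp
  (λ { (inj₁ (inj₁ (inj₁ refl))) → z≤n ; (inj₁ (inj₁ (inj₂ refl))) → s≤s z≤n
     ; (inj₁ (inj₂ (_ , _ , refl))) → z≤n ; (inj₂ (_ , p , refl)) → s≤s p })
  (λ { {zero , zero} _ → inj₁ (inj₁ (inj₁ refl))
     ; {zero , suc zero} _ → inj₁ (inj₁ (inj₂ refl))
     ; {zero , suc (suc _)} (s≤s ())
     ; {suc x , zero} _ → inj₁ (inj₂ (x , tt , refl))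
     ; {suc x , suc y} (s≤s p) → inj₂ ((x , y) , p , refl) })
  (count-⊎ (λ { (inj₁ (inj₁ refl)) (_ , _ , ()) ; (inj₁ (inj₂ refl)) (_ , _ , ())
              ; (inj₂ (_ , _ , refl)) (_ , _ , ()) })
    (count-⊎ (λ { (inj₁ refl) (_ , _ , ()) ; (inj₂ refl) (_ , _ , ()) })
      (count-⊎ (λ { refl () }) (count-singleton (zero , zero)) (count-singleton (zero , suc zero)))
      (count-image (λ x → suc x , zero) (λ { refl → refl }) (count-Fin (suc e))))
    (count-image (λ (x , y) → suc x , suc y) (λ { refl → refl }) (count-nearlyBelow e)))

-- The numerator before subtraction is 2 plus an even number, so both the truncated subtraction and
-- the division are exact.
nearlyBelow-formula : (e : ℕ) → (suc e * suc e + 3 * suc e ∸ 2) / 2 ≡ nearlyBelow e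
nearlyBelow-formula e = trans (cong (λ t → (t ∸ 2) / 2) (twice e)) (m*n/n≡m (nearlyBelow e) 2)
  where
  open +-*-Solver
  twice : ∀ e → suc e * suc e + 3 * suc e ≡ 2 + nearlyBelow e * 2
  twice zero = refl
  twice (suc e) = trans
    -- Passing from d to d + 1 adds 2d + 4 to d² + 3d, which is `6 + e + e` for d = `suc e`.
    (solve 1 (λ e → (con 2 :+ e) :* (con 2 :+ e) :+ con 3 :* (con 2 :+ e) :=
                    (con 6 :+ e :+ e) :+ ((con 1 :+ e) :* (con 1 :+ e) :+ con 3 :* (con 1 :+ e))) refl e)
    (trans (cong (λ t → 6 + e + e + t) (twice e))
      (solve 2 (λ e t → (con 6 :+ e :+ e) :+ (con 2 :+ t :* con 2) :=
                        con 2 :+ (con 3 :+ e :+ t) :* con 2) refl e (nearlyBelow e)))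

-- This is (F3) at a single index r. Its two inequalities are independent mirror images, whence the
-- square of `nearlyBelow e` in `count-Close`.
Close : {d : ℕ} → Fin d × Fin d → Fin d × Fin d → Set
Close (x , y) (x′ , y′) = toℕ x′ ≤ suc (toℕ x) × toℕ y ≤ suc (toℕ y′)

count-Close : (e : ℕ) → Count (uncurry (Close {suc e})) (nearlyBelow e * nearlyBelow e)
count-Close e = count-resp
  (λ { (_ , _ , p , q , refl) → p , q })
  (λ { {(x , y) , (x′ , y′)} (p , q) → (x , x′) , (y′ , y) , p , q , refl })
  (count-image₂ (λ (x , x′) (y′ , y) → (x , y) , (x′ , y′)) (λ { refl → refl , refl })
    (count-nearlyBelow e) (count-nearlyBelow e))

count-pairs : (d : ℕ) → Count {Fin d × Fin d} (λ _ → ⊤) (d * d)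
count-pairs d = count-all₂ _,_ ,-injective (λ (x , y) → x , y , refl) (count-Fin d) (count-Fin d)

count-zero₁ : (e : ℕ) → Count {Fin (suc e) × Fin (suc e)} (λ p → toℕ (proj₁ p) ≡ 0) (suc e)
count-zero₁ e = count-resp (λ { (_ , _ , refl) → refl }) (λ { {zero , y} _ → y , tt , refl })
  (count-image (zero ,_) (cong proj₂) (count-Fin (suc e)))

count-zero₂ : (e : ℕ) → Count {Fin (suc e) × Fin (suc e)} (λ p → toℕ (proj₂ p) ≡ 0) (suc e)
count-zero₂ e = count-resp (λ { (_ , _ , refl) → refl }) (λ { {x , zero} _ → x , tt , refl })
  (count-image (_, zero) (cong proj₁) (count-Fin (suc e)))

_≟ᵥ_ : {k d : ℕ} → DecidableEquality (Vec (Fin d × Fin d) k)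
_≟ᵥ_ = ≡-dec (Product.≡-dec Fin._≟_ Fin._≟_)

-- Here `u` counts the arcs among the u_i and `t` the arcs (F3). Both omit a diagonal, so they are
-- pinned down by equations; (F1) and (F2) contribute the two equal middle terms.
count-GammaBar : (k e : ℕ) → ∃₂ λ u t →
  Count (uncurry (GammaBarArc k (suc e)))
    (u + (k * (suc e * (suc e * suc e) ^ pred k) + k * (suc e * (suc e * suc e) ^ pred k)) + t)
  × u + k ≡ k * k
  × t + (suc e * suc e) ^ k ≡ (nearlyBelow e * nearlyBelow e) ^ k
count-GammaBar k e
  with u , cᵤ , eqᵤ ← count-off-diagonal {R = λ _ _ → ⊤} Fin._≟_ tt (count-Fin k) (count-pairs k)
  with t , cₜ , eqₜ ← count-off-diagonal {R = λ a b → ∀ r → Close (lookup a r) (lookup b r)}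
                        _≟ᵥ_ (λ _ → n≤1+n _ , n≤1+n _)
                        (count-Vec (count-pairs (suc e)) k) (count-pointwise (count-Close e) k)
  = u , t , count , eqᵤ , eqₜ
  where
  V = GVert k (suc e)
  count = count-resp
    (λ { (inj₁ (inj₁ (_ , (_ , ne) , refl))) → uu _ _ ne
       ; (inj₁ (inj₂ (inj₁ (_ , p , refl)))) → old (F1 _ _ p)
       ; (inj₁ (inj₂ (inj₂ (_ , p , refl)))) → old (F2 _ _ p)
       ; (inj₂ (_ , (p , ne) , refl)) → old (F3 _ _ ne (proj₁ ∘ p) (proj₂ ∘ p)) })
    (λ { (uu i j ne) → inj₁ (inj₁ ((i , j) , (tt , ne) , refl))
       ; (old (F1 i a p)) → inj₁ (inj₂ (inj₁ ((i , a) , p , refl)))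
       ; (old (F2 i a p)) → inj₁ (inj₂ (inj₂ ((i , a) , p , refl)))
       ; (old (F3 a b ne p q)) → inj₂ ((a , b) , ((λ r → p r , q r) , ne) , refl) })
    (count-⊎ (λ { (inj₁ (_ , _ , refl)) (_ , _ , ())
                ; (inj₂ (inj₁ (_ , _ , refl))) (_ , _ , ())
                ; (inj₂ (inj₂ (_ , _ , refl))) (_ , _ , ()) })
      (count-⊎ (λ { (_ , _ , refl) (inj₁ (_ , _ , ())) ; (_ , _ , refl) (inj₂ (_ , _ , ())) })
        (count-image {B = V × V} (λ (i , j) → inj₁ i , inj₁ j) (λ { refl → refl }) cᵤ)
        (count-⊎ (λ { (_ , _ , refl) (_ , _ , ()) })
          (count-image {B = V × V} (λ (i , a) → inj₁ i , inj₂ a) (λ { refl → refl })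
            (count-lookup (count-pairs (suc e)) (count-zero₁ e) k))
          (count-image {B = V × V} (λ (i , a) → inj₂ a , inj₁ i) (λ { refl → refl })
            (count-lookup (count-pairs (suc e)) (count-zero₂ e) k))))
      (count-image {B = V × V} (λ (a , b) → inj₂ a , inj₂ b) (λ { refl → refl }) cₜ))

square-^ : (m k : ℕ) → (m * m) ^ k ≡ m ^ (2 * k)
square-^ m k = trans (cong (λ t → (m * t) ^ k) (sym (*-identityʳ m))) (^-*-assoc m 2 k)

-- With d = `suc e`, the number `E` is d^(2(k+1)-1). The arcs (F1) and (F2) give 2(k+1) `E`, and the
-- excluded diagonal of tuples has (d²)^(k+1) = d `E` elements; together they produce the factor
-- 2(k+1) - d. It may be negative, hence the integers.
upperBound-formula : (k e u t : ℕ) → u + suc k ≡ suc k * suc k →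
  t + (suc e * suc e) ^ suc k ≡ (nearlyBelow e * nearlyBelow e) ^ suc k →
  + (u + (suc k * (suc e * (suc e * suc e) ^ k) + suc k * (suc e * (suc e * suc e) ^ k)) + t)
  ≡ upperBound (suc k) (suc e)
upperBound-formula k e u t eqᵤ eqₜ = begin
  + (u + (suc k * E + suc k * E) + t)
    ≡⟨ cong +_ (solve′ u (suc k) E t) ⟩
  + (u + (2 * suc k * E + t))
    ≡⟨ cong (λ z → + u ℤ.+ (z ℤ.+ + t)) (ℤ.pos-* (2 * suc k) E) ⟩
  + u ℤ.+ (+ (2 * suc k) ℤ.* + E ℤ.+ + t)
    -- Adding and subtracting d `E` and the number of the u_i completes the sums to which `eqₜ` and
    -- `eqᵤ` apply.
    ≡⟨ solve 6 (λ u k K d E t → u :+ (K :* E :+ t) :=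
         (t :+ d :* E) :+ (K :- d) :* E :+ ((u :+ k) :- k)) refl
         (+ u) (+ suc k) (+ (2 * suc k)) (+ suc e) (+ E) (+ t) ⟩
  (+ t ℤ.+ + suc e ℤ.* + E) ℤ.+ K ℤ.* + E ℤ.+ (+ (u + suc k) ℤ.- + suc k)
    ≡⟨ cong₂ (λ a b → (+ t ℤ.+ a) ℤ.+ K ℤ.* + E ℤ.+ (+ b ℤ.- + suc k))
         (trans (sym (ℤ.pos-* (suc e) E)) (cong +_ (sym (*-assoc (suc e) (suc e) ((suc e * suc e) ^ k)))))
         eqᵤ ⟩
  + (t + (suc e * suc e) ^ suc k) ℤ.+ K ℤ.* + E ℤ.+ (+ (suc k * suc k) ℤ.- + suc k)
    ≡⟨ cong₂ (λ a b → + a ℤ.+ K ℤ.* + b ℤ.+ (+ (suc k * suc k) ℤ.- + suc k))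
         (trans eqₜ (trans (square-^ (nearlyBelow e) (suc k))
           (cong (_^ (2 * suc k)) (sym (nearlyBelow-formula e)))))
         (trans (cong (suc e *_) (square-^ (suc e) k)) (cong (suc e ^_) (sym (+-suc k (k + 0))))) ⟩
  upperBound (suc k) (suc e) ∎
  where
  open ≡-Reasoning
  open ℤ-Solver.+-*-Solver using (solve; _:=_; _:+_; _:*_; _:-_)
  E = suc e * (suc e * suc e) ^ k
  K = + (2 * suc k) ℤ.- + suc e
  solve′ : ∀ u k E t → u + (k * E + k * E) + t ≡ u + (2 * k * E + t)
  solve′ = S.solve 4 (λ u k E t → u S.:+ (k S.:* E S.:+ k S.:* E) S.:+ t S.:=
                                 u S.:+ (S.con 2 S.:* k S.:* E S.:+ t)) refl
    where module S = +-*-Solver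

abstract

  count-upperBound : (k e : ℕ) →
    ∃[ N ] Count (uncurry (GammaBarArc (suc k) (suc e))) N × + N ≡ upperBound (suc k) (suc e)
  count-upperBound k e = let u , t , count , eqᵤ , eqₜ = count-GammaBar (suc k) e in
    _ , count , upperBound-formula k e u t eqᵤ eqₜ

-- Distances

least : {P : ℕ → Set} → Decidable P → (m : ℕ) → P m → ∃[ l ] P l × (∀ m′ → P m′ → l ≤ m′)
least P? zero p = zero , p , λ _ _ → z≤n
least P? (suc m) p with P? zero
... | yes p₀ = zero , p₀ , λ _ _ → z≤n
... | no ¬p₀ = let l , q , minimal = least (P? ∘ suc) m p in
  suc l , q , λ { zero p₀ → contradiction p₀ ¬p₀ ; (suc m′) p′ → s≤s (minimal m′ p′) }

arc⇒≢ : (G : Digraph) → ∀ {x y} → arc G x y ≡ true → x ≢ y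
arc⇒≢ G {x} a refl with () ← trans (sym a) (noLoops G x)

module _ {G : Digraph} where

  -- For a fixed length the search is finite; with the walk supplied by strong connectivity as a
  -- bound, `least` then finds the distance.
  walk? : (m : ℕ) (x y : Fin (n G)) → Dec (Walk G x y m)
  walk? zero x y = map′ (λ { refl → nil }) (λ { nil → refl }) (x Fin.≟ y)
  walk? (suc m) x y = map′ (λ { (_ , a , w) → cons a w }) (λ { (cons a w) → _ , a , w })
    (any? λ z → (arc G x z Bool.≟ true) ×-dec walk? m z y)

  snoc : ∀ {x y z m} → Walk G x y m → arc G y z ≡ true → Walk G x z (suc m)
  snoc nil a = cons a nil
  snoc (cons b w) a = cons b (snoc w a)

  dist-unique : ∀ {x y m m′} → Dist G x y m → Dist G x y m′ → m ≡ m′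
  dist-unique (w , min) (w′ , min′) = ≤-antisym (min _ w′) (min′ _ w)

module Distance {G : Digraph} (sc : StronglyConnected G) where

  abstract

    dist : Fin (n G) → Fin (n G) → ℕ
    dist x y = proj₁ (least (λ m → walk? m x y) (proj₁ (sc x y)) (proj₂ (sc x y)))

    dist-Dist : ∀ x y → Dist G x y (dist x y)
    dist-Dist x y = proj₂ (least (λ m → walk? m x y) (proj₁ (sc x y)) (proj₂ (sc x y)))

  dist≤ : ∀ {x y m} → Walk G x y m → dist x y ≤ m
  dist≤ = proj₂ (dist-Dist _ _) _

  dist-self : ∀ x → dist x x ≡ 0
  dist-self x = n≤0⇒n≡0 (dist≤ nil)

  dist-arcʳ : ∀ z {x y} → arc G x y ≡ true → dist z y ≤ suc (dist z x)
  dist-arcʳ z a = dist≤ (snoc (proj₁ (dist-Dist z _)) a)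

  dist-arcˡ : ∀ z {x y} → arc G x y ≡ true → dist x z ≤ suc (dist y z)
  dist-arcˡ z a = dist≤ (cons a (proj₁ (dist-Dist _ z)))

  dist-0 : ∀ {x y} → dist x y ≡ 0 → x ≡ y
  dist-0 {x} {y} eq with subst (Walk G x y) eq (proj₁ (dist-Dist x y))
  ... | nil = refl

  -- Passes from equal computed distances to the form used in `WeaklyResolving`, where distance is a
  -- relation.
  dist-cong : ∀ {x y x′ y′} → dist x y ≡ dist x′ y′ → ∀ m → Dist G x y m ⇔ Dist G x′ y′ m
  dist-cong {x} {y} {x′} {y′} eq m = mk⇔
    (λ δ → subst (Dist G x′ y′) (trans (sym eq) (dist-unique (dist-Dist x y) δ)) (dist-Dist x′ y′))
    (λ δ → subst (Dist G x y) (trans eq (dist-unique (dist-Dist x′ y′) δ)) (dist-Dist x y))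

  SameDistances : {k : ℕ} → (Fin k → Fin (n G)) → Fin (n G) → Fin (n G) → Set
  SameDistances mark u v = ∀ i → dist (mark i) u ≡ dist (mark i) v × dist u (mark i) ≡ dist v (mark i)

  Resolves : {k : ℕ} → (Fin k → Fin (n G)) → Set
  Resolves mark = ∀ u v → SameDistances mark u v → u ≡ v

-- The upper bound

count-enumeration : {A : Set} {P : A → Set} {m : ℕ} → Count P m →
                    Σ (Fin m → A) λ e → ∀ {x} → P x → ∃[ i ] e i ≡ x
count-enumeration record { list = xs ; complete = complete ; size = refl } =
  List.lookup xs , λ p → index (complete p) , sym (lookup-index (complete p))

-- Equality of arc counts yields preimages of arcs only; since no vertex is isolated, it also yields
-- preimages of vertices. The witnesses: u_i has an arc to the all-ones tuple, a tuple with a_1 = 1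
-- has one from u_1, and any other tuple has one to itself with a_1 lowered to 1.
GammaBar-touches : {k e : ℕ} (v : GVert (suc k) (suc e)) →
                   ∃[ w ] (GammaBarArc (suc k) (suc e) v w ⊎ GammaBarArc (suc k) (suc e) w v)
GammaBar-touches (inj₁ i) = inj₂ (Vec.replicate _ (zero , zero)) ,
  inj₁ (old (F1 _ _ (cong (toℕ ∘ proj₁) (lookup-replicate i (zero , zero)))))
GammaBar-touches (inj₂ ((zero , y) ∷ a)) = inj₁ zero , inj₂ (old (F1 _ _ refl))
GammaBar-touches (inj₂ ((suc x , y) ∷ a)) = inj₂ ((zero , y) ∷ a) , inj₁ (old (F3 _ _ (λ ())
  (λ { zero → z≤n ; (suc r) → n≤1+n _ }) (λ { zero → n≤1+n _ ; (suc r) → n≤1+n _ })))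

_≟ᵍ_ : {k d : ℕ} → DecidableEquality (GVert k d)
_≟ᵍ_ = Sum.≡-dec Fin._≟_ _≟ᵥ_

module Embedding {G : Digraph} (sc : StronglyConnected G) {k d : ℕ}
  (diam : ∀ x y m → Dist G x y m → m ≤ d)
  (mark : Fin k → Fin (n G))
  (resolves : Distance.Resolves sc mark) where

  open Distance sc

  -- A relation, so that an arc can be analysed by matching on the codes of both ends. A distance t
  -- in 1..d is stored as t - 1.
  data Code (x : Fin (n G)) : GVert k d → Set where
    marked   : ∀ i → mark i ≡ x → Code x (inj₁ i)
    unmarked : ∀ a → (∀ i → dist (mark i) x ≡ suc (toℕ (proj₁ (lookup a i)))
                          × dist x (mark i) ≡ suc (toℕ (proj₂ (lookup a i)))) → Code x (inj₂ a)

  coordinate : ∀ {x y} → x ≢ y → ∃[ c ] dist x y ≡ suc (toℕ {d} c)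
  coordinate {x} {y} x≢y with dist x y in eq | diam x y _ (dist-Dist x y)
  ... | zero  | _     = contradiction (dist-0 eq) x≢y
  ... | suc m | 1+m≤d = fromℕ< 1+m≤d , cong suc (sym (toℕ-fromℕ< 1+m≤d))

  code : ∀ x → ∃ (Code x)
  code x with any? (λ i → mark i Fin.≟ x)
  ... | yes (i , eq) = inj₁ i , marked i eq
  ... | no ¬marked = inj₂ (Vec.tabulate λ i → proj₁ (from i) , proj₁ (to i)) , unmarked _ λ i →
      trans (proj₂ (from i)) (cong (λ p → 1 + toℕ (proj₁ p)) (sym (lookup∘tabulate _ i))) ,
      trans (proj₂ (to i)) (cong (λ p → 1 + toℕ (proj₂ p)) (sym (lookup∘tabulate _ i)))
    where
    from = λ i → coordinate {mark i} {x} (λ eq → ¬marked (i , eq))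
    to   = λ i → coordinate {x} {mark i} (λ eq → ¬marked (i , sym eq))

  -- Two vertices sharing a tuple have equal distances from and to every mark; this is where
  -- resolving enters.
  code-injective : ∀ {x y v} → Code x v → Code y v → x ≡ y
  code-injective (marked _ eq) (marked _ eq′) = trans (sym eq) eq′
  code-injective (unmarked _ δ) (unmarked _ δ′) = resolves _ _ λ i →
    trans (proj₁ (δ i)) (sym (proj₁ (δ′ i))) , trans (proj₂ (δ i)) (sym (proj₂ (δ′ i)))

  -- Along an arc the distance from a mark grows by at most 1 and the distance to a mark drops by at
  -- most 1, which is (F3). An arc leaving or entering a mark gives distance 1, stored as 0, which
  -- is (F1) or (F2). Marks may be adjacent to each other, so the target is Γ̄ and not Γ.
  code-arc : ∀ {x y v w} → arc G x y ≡ true → Code x v → Code y w → GammaBarArc k d v w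
  code-arc xy (marked i eq) (marked j eq′) =
    uu i j λ { refl → arc⇒≢ G xy (trans (sym eq) eq′) }
  code-arc xy (marked i refl) (unmarked a δ) = old (F1 i a (n≤0⇒n≡0 (≤-pred
    (subst (_≤ 1) (proj₁ (δ i)) (dist≤ (cons xy nil))))))
  code-arc xy (unmarked a δ) (marked i refl) = old (F2 i a (n≤0⇒n≡0 (≤-pred
    (subst (_≤ 1) (proj₂ (δ i)) (dist≤ (cons xy nil))))))
  code-arc xy (unmarked a δ) (unmarked b δ′) = old (F3 a b
    (λ { refl → arc⇒≢ G xy (code-injective (unmarked a δ) (unmarked a δ′)) })
    (λ r → ≤-pred (subst₂ (λ s t → s ≤ suc t) (proj₁ (δ′ r)) (proj₁ (δ r)) (dist-arcʳ (mark r) xy)))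
    (λ r → ≤-pred (subst₂ (λ s t → s ≤ suc t) (proj₂ (δ r)) (proj₂ (δ′ r)) (dist-arcˡ (mark r) xy))))

  φ : Fin (n G) → GVert k d
  φ x = proj₁ (code x)

  φ-injective : ∀ {x y} → φ x ≡ φ y → x ≡ y
  φ-injective {x} {y} eq = code-injective (subst (Code x) eq (proj₂ (code x))) (proj₂ (code y))

  module _ {N : ℕ} (count : Count (uncurry (GammaBarArc k d)) N) where

    private
      φ² : Fin (n G) × Fin (n G) → GVert k d × GVert k d
      φ² (x , y) = φ x , φ y

      φ²-arc : ∀ {p} → arc G (proj₁ p) (proj₂ p) ≡ true → uncurry (GammaBarArc k d) (φ² p)
      φ²-arc {x , y} xy = code-arc xy (proj₂ (code x)) (proj₂ (code y))

      φ²-injective : ∀ {p q} → φ² p ≡ φ² q → p ≡ q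
      φ²-injective eq = let eq₁ , eq₂ = ,-injective eq in cong₂ _,_ (φ-injective eq₁) (φ-injective eq₂)

    arcCount≤ : arcCount G ≤ N
    arcCount≤ = count-≤ φ² φ²-arc (λ _ _ → φ²-injective) (count-arcs G) count

    module Extremal (extremal : arcCount G ≡ N) where

      -- An injection between finite sets of equal size is onto.
      arc-preimage : ∀ {v w} → GammaBarArc k d v w → ∃₂ λ x y → arc G x y ≡ true × v ≡ φ x × w ≡ φ y
      arc-preimage a = let (x , y) , xy , eq = count-onto φ² φ²-arc (λ _ _ → φ²-injective)
                             (count-arcs G) count (Product.≡-dec _≟ᵍ_ _≟ᵍ_) extremal a
                       in x , y , xy , ,-injective eq

      φ-reflects : ∀ {x y} → GammaBarArc k d (φ x) (φ y) → arc G x y ≡ true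
      φ-reflects a with x′ , y′ , xy , eq₁ , eq₂ ← arc-preimage a
        with refl ← φ-injective eq₁ | refl ← φ-injective eq₂ = xy

module _ {G : Digraph} (sc : StronglyConnected G) {k e : ℕ}
  (diam : ∀ x y m → Dist G x y m → m ≤ suc e)
  (mark : Fin (suc k) → Fin (n G))
  (resolves : Distance.Resolves sc mark)
  {N : ℕ} (count : Count (uncurry (GammaBarArc (suc k) (suc e))) N) (extremal : arcCount G ≡ N) where

  open Embedding sc diam mark resolves
  open Extremal count extremal

  φ-onto : ∀ v → ∃[ x ] φ x ≡ v
  φ-onto v with GammaBar-touches v
  ... | _ , inj₁ a = let x , _ , _ , eq , _ = arc-preimage a in x , sym eq
  ... | _ , inj₂ a = let _ , y , _ , _ , eq = arc-preimage a in y , sym eq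

  extremal-iso : Iso G (GVert (suc k) (suc e)) (GammaBarArc (suc k) (suc e))
  extremal-iso = mk↔ₛ′ φ (proj₁ ∘ φ-onto) (proj₂ ∘ φ-onto) (λ x → φ-injective (proj₂ (φ-onto (φ x)))) ,
    λ x y → mk⇔ (λ xy → code-arc xy (proj₂ (code x)) (proj₂ (code y))) φ-reflects

  -- In an extremal digraph the marks are joined by arcs, so their distances to any third vertex
  -- differ by at most 1; for k ≥ 2 and d ≥ 3 this excludes the tuple with a_1 = 3 and a_3 = 1.
  marks-close : ∀ {i j} → i ≢ j → ∀ a → toℕ (proj₁ (lookup a j)) ≡ 0 → toℕ (proj₁ (lookup a i)) ≤ 1
  marks-close {i} {j} i≢j a a≡0 =
    let x₀ , eq₀ = φ-onto (inj₁ i) ; x₁ , eq₁ = φ-onto (inj₁ j) ; y , eq = φ-onto (inj₂ a) in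
    two-steps (subst (Code x₀) eq₀ (proj₂ (code x₀))) (subst (Code y) eq (proj₂ (code y)))
      (φ-reflects (subst₂ (GammaBarArc _ _) (sym eq₀) (sym eq₁) (uu _ _ i≢j)))
      (φ-reflects (subst₂ (GammaBarArc _ _) (sym eq₁) (sym eq) (old (F1 _ _ a≡0))))
    where
    two-steps : ∀ {i a x₀ x₁ y} → Code x₀ (inj₁ i) → Code y (inj₂ a) →
                arc G x₀ x₁ ≡ true → arc G x₁ y ≡ true → toℕ (proj₁ (lookup a i)) ≤ 1
    two-steps (marked i refl) (unmarked _ δ) x₀x₁ x₁y =
      ≤-pred (subst (_≤ 2) (proj₁ (δ i)) (Distance.dist≤ sc (cons x₀x₁ (cons x₁y nil))))

extremal-small : {G : Digraph} (sc : StronglyConnected G) {k e : ℕ} →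
  (diam : ∀ x y m → Dist G x y m → m ≤ suc e)
  (mark : Fin (suc k) → Fin (n G))
  (resolves : Distance.Resolves sc mark)
  {N : ℕ} → Count (uncurry (GammaBarArc (suc k) (suc e))) N → arcCount G ≡ N →
  k ≡ 0 ⊎ e ≡ 0 ⊎ e ≡ 1
extremal-small sc {zero} diam mark res count extremal = inj₁ refl
extremal-small sc {suc k} {zero} diam mark res count extremal = inj₂ (inj₁ refl)
extremal-small sc {suc k} {suc zero} diam mark res count extremal = inj₂ (inj₂ refl)
extremal-small sc {suc k} {suc (suc e)} diam mark res count extremal =
  contradiction
    (marks-close sc diam mark res count extremal {zero} {suc zero} (λ ())
      -- The tuple (3,1,1,...,1), stored one lower: distance 3 from the first mark and 1 from the
      -- second, so `marks-close` would give 2 ≤ 1.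
      ((suc (suc zero) , zero) ∷ (zero , zero) ∷ Vec.replicate k (zero , zero)) refl)
    λ { (s≤s ()) }

-- The enumeration reaches every member of `W`, so agreement at all marks is agreement on `W`.
resolving-marks : (G : Digraph) (sc : StronglyConnected G) (W : Subset (n G)) {k : ℕ} →
  ∣ W ∣ ≡ k → WeaklyResolving G W →
  Σ (Fin k → Fin (n G)) (Distance.Resolves sc)
resolving-marks G sc W refl res = mark , λ u v same → res u v λ w w∈ m → same-Dist u v same (find w∈) m
  where
  open Distance sc
  mark = proj₁ (count-enumeration (count-subset W))
  find = proj₂ (count-enumeration (count-subset W))
  same-Dist : ∀ u v {w} →
    SameDistances mark u v → ∃[ i ] mark i ≡ w → ∀ m → (Dist G w u m ⇔ Dist G w v m) × (Dist G u w m ⇔ Dist G v w m)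
  same-Dist u v same (i , refl) m = dist-cong (proj₁ (same i)) m , dist-cong (proj₂ (same i)) m

-- The extremal digraphs

↔-injective : {A B : Set} (f : A ↔ B) → ∀ {x y} → Inverse.to f x ≡ Inverse.to f y → x ≡ y
↔-injective f {x} {y} eq = trans (sym (strictlyInverseʳ x)) (trans (cong from eq) (strictlyInverseʳ y))
  where open Inverse f

↔-≢ : {A B : Set} (f : A ↔ B) (x y : A) → (x ≢ y) ⇔ (Inverse.to f x ≢ Inverse.to f y)
↔-≢ f x y = mk⇔ (λ ne eq → ne (↔-injective f eq)) (λ ne eq → ne (cong (Inverse.to f) eq))

iso-arcCount : (G : Digraph) {V : Set} {R : V → V → Set} {N : ℕ} →
               Iso G V R → Count (uncurry R) N → arcCount G ≡ N
iso-arcCount G {R = R} (f , arcs) count = ≤-antisym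
  (count-≤ (λ (x , y) → to x , to y) (λ {(x , y)} → Equivalence.to (arcs x y))
    (λ _ _ eq → let eq₁ , eq₂ = ,-injective eq in cong₂ _,_ (↔-injective f eq₁) (↔-injective f eq₂))
    (count-arcs G) count)
  (count-≤ (λ (v , w) → from v , from w)
    (λ {(v , w)} r → Equivalence.from (arcs _ _)
      (subst₂ R (sym (strictlyInverseˡ v)) (sym (strictlyInverseˡ w)) r))
    (λ _ _ eq → let eq₁ , eq₂ = ,-injective eq in cong₂ _,_ (↔-injective (↔-sym f) eq₁) (↔-injective (↔-sym f) eq₂))
    count (count-arcs G))
  where
  open Inverse f

iso-trans : (G : Digraph) {V V′ : Set} (R : V → V → Set) (R′ : V′ → V′ → Set) (g : V ↔ V′) →
            (∀ v w → R v w ⇔ R′ (Inverse.to g v) (Inverse.to g w)) → Iso G V R → Iso G V′ R′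
iso-trans G R R′ g rel (f , arcs) = ↔-trans f g , λ x y → ⇔-trans (arcs x y) (rel _ _)

iso-trans⁻ : (G : Digraph) {V V′ : Set} (R : V → V → Set) (R′ : V′ → V′ → Set) (g : V ↔ V′) →
             (∀ v w → R v w ⇔ R′ (Inverse.to g v) (Inverse.to g w)) → Iso G V′ R′ → Iso G V R
iso-trans⁻ G R R′ g rel = iso-trans G R′ R (↔-sym g) λ v w →
  subst₂ (λ v′ w′ → R′ v′ w′ ⇔ R (from v) (from w)) (strictlyInverseˡ v) (strictlyInverseˡ w)
    (⇔-sym (rel (from v) (from w)))
  where open Inverse g

GammaBar₁⇔Gamma₁ : {d : ℕ} (v w : GVert 1 d) → GammaBarArc 1 d v w ⇔ GammaArc 1 d v w
GammaBar₁⇔Gamma₁ v w = mk⇔ (λ { (old a) → a ; (uu zero zero ne) → contradiction refl ne }) old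

unit-tuple : {k : ℕ} (a : Vec (Fin 1 × Fin 1) k) → a ≡ Vec.replicate k (zero , zero)
unit-tuple [] = refl
unit-tuple ((zero , zero) ∷ a) = cong (_ ∷_) (unit-tuple a)

unit-tuples↔Fin : (k : ℕ) → Vec (Fin 1 × Fin 1) k ↔ Fin 1
unit-tuples↔Fin k = mk↔ₛ′ (λ _ → zero) (λ _ → Vec.replicate k (zero , zero))
  (λ { zero → refl }) (sym ∘ unit-tuple)

GVert₁↔Fin : (k : ℕ) → GVert k 1 ↔ Fin (k + 1)
GVert₁↔Fin k = ↔-trans (↔-refl ⊎-↔ unit-tuples↔Fin k) (↔-sym Fin.+↔⊎)

-- For d = 1 every entry is 1, so (F1) and (F2) always hold, and there is only one tuple.
GammaBar-d₁⇔≢ : {k : ℕ} (v w : GVert k 1) → GammaBarArc k 1 v w ⇔ (v ≢ w)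
GammaBar-d₁⇔≢ v w = mk⇔ to (from v w)
  where
  to : ∀ {v w} → GammaBarArc _ 1 v w → v ≢ w
  to (old (F3 _ _ ne _ _)) refl = ne refl
  to (uu _ _ ne) refl = ne refl
  Fin1 : (x : Fin 1) → toℕ x ≡ 0
  Fin1 zero = refl
  from : ∀ v w → v ≢ w → GammaBarArc _ 1 v w
  from (inj₁ i) (inj₁ j) ne = uu i j (ne ∘ cong inj₁)
  from (inj₁ i) (inj₂ a) _ = old (F1 i a (Fin1 _))
  from (inj₂ a) (inj₁ i) _ = old (F2 i a (Fin1 _))
  from (inj₂ a) (inj₂ b) ne = contradiction (cong inj₂ (trans (unit-tuple a) (sym (unit-tuple b)))) ne

GammaBar-d₁⇔Complete : {k : ℕ} (v w : GVert k 1) →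
  GammaBarArc k 1 v w ⇔ CompleteArc (k + 1) (Inverse.to (GVert₁↔Fin k) v) (Inverse.to (GVert₁↔Fin k) w)
GammaBar-d₁⇔Complete {k} v w = ⇔-trans (GammaBar-d₁⇔≢ v w) (↔-≢ (GVert₁↔Fin k) v w)

-- The lower bound

module LowerBound {G : Digraph} (sc : StronglyConnected G) (s t : Fin (n G)) where

  open Distance sc

  module _ {d : ℕ} (d≡ : dist s t ≡ d) where

    -- A discrete intermediate value theorem: the distance from `s` rises by at most 1 along an arc,
    -- so no value is skipped.
    intermediate : ∀ {x y m i} → Walk G x y m → dist s x ≤ i → i ≤ dist s y → ∃[ p ] dist s p ≡ i
    intermediate nil x≤i i≤y = _ , ≤-antisym x≤i i≤y
    intermediate {x} {i = i} (cons a w) x≤i i≤y with dist s x ≟ i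
    ... | yes eq = x , eq
    ... | no ne = intermediate w (≤-trans (dist-arcʳ s a) (≤∧≢⇒< x≤i ne)) i≤y

    -- The walk from `s` to `t` is arbitrary, so vertices of successive levels need not be adjacent;
    -- their distances from `s` are what matters. Levels start at 1, which keeps `s` off them.
    level : (i : Fin d) → ∃[ p ] dist s p ≡ suc (toℕ i)
    level i = intermediate (proj₂ (sc s t)) (subst (_≤ _) (sym (dist-self s)) z≤n)
      (subst (suc (toℕ i) ≤_) (sym d≡) (toℕ<n i))

    geodesic : Fin d → Fin (n G)
    geodesic = proj₁ ∘ level

    geodesic-injective : ∀ {i j} → dist s (geodesic i) ≡ dist s (geodesic j) → i ≡ j
    geodesic-injective {i} {j} eq = toℕ-injective (suc-injective
      (trans (sym (proj₂ (level i))) (trans eq (proj₂ (level j)))))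

    onGeodesic? : Decidable (λ v → ∃[ i ] geodesic i ≡ v)
    onGeodesic? v = any? λ i → geodesic i Fin.≟ v

    offGeodesic : Subset (n G)
    offGeodesic = Vec.tabulate λ v → does (¬? (onGeodesic? v))

    ∈-off⁺ : ∀ {v} → ¬ (∃[ i ] geodesic i ≡ v) → v ∈ₛ offGeodesic
    ∈-off⁺ {v} ¬on = lookup⇒[]= v _ (trans (lookup∘tabulate _ v) (dec-true (¬? (onGeodesic? v)) ¬on))

    ∈-off⁻ : ∀ {v} → v ∈ₛ offGeodesic → ¬ (∃[ i ] geodesic i ≡ v)
    ∈-off⁻ {v} v∈ on with () ← trans (sym ([]=⇒lookup v∈))
      (trans (lookup∘tabulate _ v) (dec-false (¬? (onGeodesic? v)) (λ ¬on → ¬on on)))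

    start∈off : s ∈ₛ offGeodesic
    start∈off = ∈-off⁺ λ (i , eq) → 0≢1+n
      (trans (sym (dist-self s)) (trans (cong (dist s) (sym eq)) (proj₂ (level i))))

    -- A vertex off the geodesic is told apart from all others by its distance 0 from itself. Two
    -- vertices on it lie at different distances from `s`, which is off it.
    off-resolving : WeaklyResolving G offGeodesic
    off-resolving u v same with onGeodesic? u | onGeodesic? v
    ... | no u∉ | _ with Equivalence.to (proj₁ (same u (∈-off⁺ u∉) 0)) (nil , λ _ _ → z≤n)
    ...   | nil , _ = refl
    off-resolving u v same | yes _ | no v∉
      with Equivalence.from (proj₁ (same v (∈-off⁺ v∉) 0)) (nil , λ _ _ → z≤n)
    ...   | nil , _ = refl
    off-resolving u v same | yes (i , refl) | yes (j , refl) = cong geodesic (geodesic-injective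
      (dist-unique (Equivalence.to (proj₁ (same s start∈off _)) (dist-Dist s u)) (dist-Dist s v)))

    off-size : ∣ offGeodesic ∣ + d ≤ n G
    off-size = count-≤ id _ (λ _ _ eq → eq)
      (count-⊎ (λ { v∈ (i , _ , eq) → ∈-off⁻ v∈ (i , sym eq) })
        (count-subset offGeodesic)
        (count-image geodesic (λ eq → geodesic-injective (cong (dist s) eq)) (count-Fin d)))
      (count-Fin (n G))

    order-≥ : ∀ {k} → (∀ W → WeaklyResolving G W → k ≤ ∣ W ∣) → k + d ≤ n G
    order-≥ minimal = ≤-trans (+-monoˡ-≤ d (minimal offGeodesic off-resolving)) off-size

  module _ (s≢t : s ≢ t) where

    -- The walks from `v` to `s` and to `t` cannot both be empty, and a nonempty one begins with an
    -- arc.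
    out-arc : ∀ v → ∃[ w ] arc G v w ≡ true
    out-arc v with sc v s | sc v t
    ... | _ , cons a _ | _            = _ , a
    ... | _ , nil      | _ , cons a _ = _ , a
    ... | _ , nil      | _ , nil      = contradiction refl s≢t

    next : Fin (n G) → Fin (n G)
    next v = proj₁ (out-arc v)

    order≤arcCount : n G ≤ arcCount G
    order≤arcCount = count-≤ (λ v → v , next v) (λ {v} _ → proj₂ (out-arc v)) (λ _ _ → cong proj₁)
      (count-Fin (n G)) (count-arcs G)

    -- The arcs from each `v` to `next v` already number `n G`, so they are all the arcs.
    next-functional : n G ≡ arcCount G → ∀ {x y} → arc G x y ≡ true → y ≡ next x
    next-functional eq xy with _ , _ , refl ← count-onto (λ v → v , next v)
      (λ {v} _ → proj₂ (out-arc v)) (λ _ _ → cong proj₁) (count-Fin (n G)) (count-arcs G)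
      (Product.≡-dec Fin._≟_ Fin._≟_) eq xy = refl

-- Strongly connected digraphs with unique out-arcs

module Deterministic {G : Digraph} (sc : StronglyConnected G) {d : ℕ}
  (diam : ∀ x y m → Dist G x y m → m ≤ d) (s t : Fin (n G)) (d≡ : Distance.dist sc s t ≡ d)
  (next : Fin (n G) → Fin (n G)) (next-arc : ∀ x → arc G x (next x) ≡ true)
  (functional : ∀ {x y} → arc G x y ≡ true → y ≡ next x) where

  open Distance sc

  iter : ℕ → Fin (n G)
  iter zero = s
  iter (suc m) = next (iter m)

  walk-iter : ∀ m → Walk G s (iter m) m
  walk-iter zero = nil
  walk-iter (suc m) = snoc (walk-iter m) (next-arc (iter m))

  walk⇒iter : ∀ {x y m} j → x ≡ iter j → Walk G x y m → y ≡ iter (m + j)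
  walk⇒iter j eq nil = eq
  walk⇒iter {m = suc m} j refl (cons a w) =
    trans (walk⇒iter (suc j) (functional a) w) (cong iter (+-suc m j))

  -- Walks from `s` are forced, so the end of a shortest walk to `v` is determined by its length.
  iter-dist : ∀ v → v ≡ iter (dist s v)
  iter-dist v = trans (walk⇒iter 0 refl (proj₁ (dist-Dist s v))) (cong iter (+-identityʳ (dist s v)))

  iter-shift : ∀ c {a b} → iter a ≡ iter b → iter (c + a) ≡ iter (c + b)
  iter-shift zero eq = eq
  iter-shift (suc c) eq = cong next (iter-shift c eq)

  -- A shortcut to `iter m`, followed by `d ∸ m` further steps, would be a shortcut to `t`, which is
  -- `iter d`.
  dist-iter : ∀ {m} → m ≤ d → dist s (iter m) ≡ m
  dist-iter {m} m≤d = ≤-antisym (dist≤ (walk-iter m)) (+-cancelˡ-≤ (d ∸ m) m j d≤)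
    where
    j = dist s (iter m)
    t≡ : iter (d ∸ m + j) ≡ t
    t≡ = begin
      iter (d ∸ m + j)  ≡⟨ iter-shift (d ∸ m) (sym (iter-dist (iter m))) ⟩
      iter (d ∸ m + m)  ≡⟨ cong iter (trans (m∸n+n≡m m≤d) (sym d≡)) ⟩
      iter (dist s t)   ≡⟨ sym (iter-dist t) ⟩
      t                 ∎
      where open ≡-Reasoning
    d≤ : d ∸ m + m ≤ d ∸ m + j
    d≤ = subst₂ _≤_ (trans d≡ (sym (m∸n+n≡m m≤d))) refl
      (dist≤ (subst (λ x → Walk G s x (d ∸ m + j)) t≡ (walk-iter (d ∸ m + j))))

  -- Let `m` be the distance from `iter 1` back to `s`, so that `iter (suc m)` is `s`. The diameter
  -- gives `m ≤ d`; if `m < d`, then `dist-iter` would put `s` at distance `suc m` from itself.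
  wraps : next (iter d) ≡ s
  wraps with dist (iter 1) s | dist-Dist (iter 1) s
  ... | m | δ = sym (trans s≡ (cong iter (cong suc (≤-antisym m≤d d≤m))))
    where
    s≡ : s ≡ iter (suc m)
    s≡ = trans (walk⇒iter 1 refl (proj₁ δ)) (cong iter (+-comm m 1))
    m≤d = diam (iter 1) s m δ
    d≤m : d ≤ m
    d≤m = ≮⇒≥ λ m<d → 0≢1+n (trans (sym (dist-self s)) (trans (cong (dist s) s≡) (dist-iter m<d)))

  dist≤d : ∀ v → dist s v ≤ d
  dist≤d v = diam s v _ (dist-Dist s v)

  position : Fin (n G) → Fin (suc d)
  position v = fromℕ< (s≤s (dist≤d v))

  toℕ-position : ∀ v → toℕ (position v) ≡ dist s v
  toℕ-position v = toℕ-fromℕ< (s≤s (dist≤d v))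

  position↔ : Fin (n G) ↔ Fin (suc d)
  position↔ = mk↔ₛ′ position (iter ∘ toℕ)
    (λ i → toℕ-injective (trans (toℕ-position _) (dist-iter (≤-pred (toℕ<n i)))))
    (λ v → trans (cong iter (toℕ-position v)) (sym (iter-dist v)))

  arc⇒cycle : ∀ {x y} → arc G x y ≡ true → dist s y ≡ suc (dist s x) ⊎ (dist s x ≡ d × dist s y ≡ 0)
  arc⇒cycle {x} {y} xy with dist s x ≟ d
  ... | yes eq = inj₂ (eq , trans (cong (dist s) (trans y≡ (trans (cong (next ∘ iter) eq) wraps))) (dist-self s))
    where
    y≡ : y ≡ iter (suc (dist s x))
    y≡ = trans (functional xy) (cong next (iter-dist x))
  ... | no ne = inj₁ (trans (cong (dist s) (trans (functional xy) (cong next (iter-dist x))))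
    (dist-iter (≤∧≢⇒< (dist≤d x) ne)))

  cycle⇒arc : ∀ {x y} → dist s y ≡ suc (dist s x) ⊎ (dist s x ≡ d × dist s y ≡ 0) → arc G x y ≡ true
  cycle⇒arc {x} {y} c = subst (λ z → arc G x z ≡ true) (next≡ c) (next-arc x)
    where
    next≡ : dist s y ≡ suc (dist s x) ⊎ (dist s x ≡ d × dist s y ≡ 0) → next x ≡ y
    next≡ (inj₁ eq) = trans (cong next (iter-dist x)) (sym (trans (iter-dist y) (cong iter eq)))
    next≡ (inj₂ (eq , eq₀)) = trans (cong next (trans (iter-dist x) (cong iter eq)))
      (trans wraps (dist-0 eq₀))

  iso : Iso G (Fin (suc d)) (CycleArc d)
  iso = position↔ , λ x y → mk⇔
    (λ xy → subst₂ (λ i j → j ≡ suc i ⊎ (i ≡ d × j ≡ 0)) (sym (toℕ-position x)) (sym (toℕ-position y))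
      (arc⇒cycle xy))
    (λ c → cycle⇒arc (subst₂ (λ i j → j ≡ suc i ⊎ (i ≡ d × j ≡ 0)) (toℕ-position x) (toℕ-position y) c))

cycle-functional : {d : ℕ} {i j j′ : Fin (suc d)} → CycleArc d i j → CycleArc d i j′ → j ≡ j′
cycle-functional (inj₁ eq) (inj₁ eq′) = toℕ-injective (trans eq (sym eq′))
cycle-functional {j = j} (inj₁ eq) (inj₂ (eq′ , _)) =
  contradiction (trans eq (cong suc eq′)) (<⇒≢ (toℕ<n j))
cycle-functional {j′ = j} (inj₂ (eq′ , _)) (inj₁ eq) =
  contradiction (trans eq (cong suc eq′)) (<⇒≢ (toℕ<n j))
cycle-functional (inj₂ (_ , eq)) (inj₂ (_ , eq′)) = toℕ-injective (trans eq (sym eq′))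

-- Each arc of a cycle is determined by its tail. The reverse inequality comes from the general
-- lower bound with k = 1.
cycle-arcCount : (G : Digraph) {d : ℕ} → Iso G (Fin (suc d)) (CycleArc d) → arcCount G ≤ suc d
cycle-arcCount G (f , arcs) = count-≤ (to ∘ proj₁) _ injective (count-arcs G) (count-Fin _)
  where
  open Inverse f
  injective : ∀ {p q} → arc G (proj₁ p) (proj₂ p) ≡ true → arc G (proj₁ q) (proj₂ q) ≡ true →
              to (proj₁ p) ≡ to (proj₁ q) → p ≡ q
  injective {x , y} {x′ , y′} a a′ eq with refl ← ↔-injective f {x} {x′} eq =
    cong (x ,_) (↔-injective f
      (cycle-functional (Equivalence.to (arcs x y) a) (Equivalence.to (arcs x y′) a′)))

-- The extremal cases of the upper bound and the proof of the theorem

ExtremalCase : Digraph → ℕ → ℕ → Set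
ExtremalCase G k d =
  (k ≡ 1 × Iso G (GVert 1 d) (GammaArc 1 d))
  ⊎ (d ≡ 1 × Iso G (Fin (k + 1)) (CompleteArc (k + 1)))
  ⊎ (d ≡ 2 × Iso G (GVert k 2) (GammaBarArc k 2))

GammaBar⇒extremalCase : (G : Digraph) {k e : ℕ} → k ≡ 0 ⊎ e ≡ 0 ⊎ e ≡ 1 →
  Iso G (GVert (suc k) (suc e)) (GammaBarArc (suc k) (suc e)) → ExtremalCase G (suc k) (suc e)
GammaBar⇒extremalCase G (inj₁ refl) bar =
  inj₁ (refl , iso-trans G _ (GammaArc 1 _) ↔-refl GammaBar₁⇔Gamma₁ bar)
GammaBar⇒extremalCase G (inj₂ (inj₁ refl)) bar =
  inj₂ (inj₁ (refl , iso-trans G _ (CompleteArc _) (GVert₁↔Fin _) GammaBar-d₁⇔Complete bar))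
GammaBar⇒extremalCase G (inj₂ (inj₂ refl)) bar = inj₂ (inj₂ (refl , bar))

-- All three extremal digraphs are instances of Γ̄, so the single count of its arcs serves every
-- case.
extremalCase⇒GammaBar : (G : Digraph) {k d : ℕ} → ExtremalCase G k d →
                        Iso G (GVert k d) (GammaBarArc k d)
extremalCase⇒GammaBar G (inj₁ (refl , gamma)) =
  iso-trans⁻ G _ (GammaArc 1 _) ↔-refl GammaBar₁⇔Gamma₁ gamma
extremalCase⇒GammaBar G (inj₂ (inj₁ (refl , complete))) =
  iso-trans⁻ G _ (CompleteArc _) (GVert₁↔Fin _) GammaBar-d₁⇔Complete complete
extremalCase⇒GammaBar G (inj₂ (inj₂ (refl , bar))) = bar

theorem2p8 : (k d : ℕ) → 1 ≤ k → 1 ≤ d → (G : Digraph) →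
    StronglyConnected G → IsDim G k → IsDiameter G d →
    ((k + d ≤ arcCount G) × (+ arcCount G ≤ℤ upperBound k d))
    × ((k + d ≡ arcCount G) ⇔ (k ≡ 1 × Iso G (Fin (suc d)) (CycleArc d)))
    × ((+ arcCount G ≡ upperBound k d) ⇔
    ((k ≡ 1 × Iso G (GVert 1 d) (GammaArc 1 d))
    ⊎ (d ≡ 1 × Iso G (Fin (k + 1)) (CompleteArc (k + 1)))
    ⊎ (d ≡ 2 × Iso G (GVert k 2) (GammaBarArc k 2))))
theorem2p8 (suc k) (suc e) _ _ G sc ((W , W-resolving , ∣W∣≡) , minimal) (diam , s , t , δ) =
  (k+d≤arcCount , subst (+ arcCount G ≤ℤ_) N≡ (ℤ.+≤+ (Embedding.arcCount≤ sc diam mark resolves count))) ,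
  mk⇔ lower⇒cycle cycle⇒lower ,
  mk⇔ (λ eq → upper⇒extremal (ℤ.+-injective (trans eq (sym N≡))))
      (λ c → trans (cong +_ (iso-arcCount G (extremalCase⇒GammaBar G c) count)) N≡)
  where
  open Distance sc using (dist; dist-Dist; dist-self)

  d≡ : dist s t ≡ suc e
  d≡ = dist-unique (dist-Dist s t) δ

  s≢t : s ≢ t
  s≢t s≡t = 0≢1+n (trans (sym (dist-self s)) (trans (cong (dist s) s≡t) d≡))

  open LowerBound sc s t

  k+d≤order : suc k + suc e ≤ n G
  k+d≤order = order-≥ d≡ minimal

  k+d≤arcCount : suc k + suc e ≤ arcCount G
  k+d≤arcCount = ≤-trans k+d≤order (order≤arcCount s≢t)

  lower⇒cycle : suc k + suc e ≡ arcCount G → suc k ≡ 1 × Iso G (Fin (suc (suc e))) (CycleArc (suc e))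
  -- The order is at least k + d and, by the isomorphism with the cycle, at most d + 1; this forces
  -- k = 1.
  lower⇒cycle eq = cong suc (n≤0⇒n≡0 (+-cancelʳ-≤ (suc e) k 0 (≤-pred
      (≤-trans k+d≤order (Fin.injective⇒≤ (↔-injective (proj₁ iso))))))) , iso
    where
    open Deterministic sc diam s t d≡ (next s≢t) (λ x → proj₂ (out-arc s≢t x))
      -- The order lies between k + d and the number of arcs, which coincide here.
      (next-functional s≢t (≤-antisym (order≤arcCount s≢t) (subst (_≤ n G) eq k+d≤order)))

  cycle⇒lower : suc k ≡ 1 × Iso G (Fin (suc (suc e))) (CycleArc (suc e)) → suc k + suc e ≡ arcCount G
  cycle⇒lower (k≡1 , cycle) = ≤-antisym k+d≤arcCount
    (subst (λ l → arcCount G ≤ l + suc e) (sym k≡1) (cycle-arcCount G cycle))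

  marks = resolving-marks G sc W ∣W∣≡ W-resolving
  mark = proj₁ marks
  resolves = proj₂ marks

  counted = count-upperBound k e
  count = proj₁ (proj₂ counted)
  N≡ = proj₂ (proj₂ counted)

  upper⇒extremal : arcCount G ≡ proj₁ counted → ExtremalCase G (suc k) (suc e)
  upper⇒extremal eq = GammaBar⇒extremalCase G
    (extremal-small sc diam mark resolves count eq) (extremal-iso sc diam mark resolves count eq)
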